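{- Let $m$ be a positive integer and let $a_1,a_2,a_3,K$ be integers with $0\le a_1,a_2,a_3,K\le m-1$. Then $$S_m(\{a_1,a_2,a_3\},K)\le\left\lfloor\frac{m}{3}\right\rfloor.$$
   Context: For a positive integer $m$ and non-negative integers $a_1,a_2,a_3,K$ (the $a_i$ need not be distinct; $\{a_1,a_2,a_3\}$ is just a list of parameters), define $$\begin{aligned}S_m(\{a_1,a_2,a_3\},K)=\sum_{k=0}^K\Bigl(&\left\lfloor\tfrac{a_1+a_2+a_3+k}{m}\right\rfloor-\left\lfloor\tfrac{a_1+a_2+k}{m}\right\rfloor-\left\lfloor\tfrac{a_2+a_3+k}{m}\right\rfloor-\left\lfloor\tfrac{a_1+a_3+k}{m}\right\rfloor\\&+\left\lfloor\tfrac{a_1+k}{m}\right\rfloor+\left\lfloor\tfrac{a_2+k}{m}\right\rfloor+\left\lfloor\tfrac{a_3+k}{m}\right\rfloor-\left\lfloor\tfrac{k}{m}\right\rfloor\Bigr).\end{aligned}$$ -}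

module Defs where

open import Data.Fin.Base using (toℕ)
open import Data.Integer.Base using (ℤ; +_; _+_; _-_)
open import Data.Integer.Properties using (+-0-commutativeMonoid)
open import Data.Nat.Base as ℕ using (ℕ; NonZero; _/_)
open import Algebra.Properties.CommutativeMonoid.Sum +-0-commutativeMonoid
  using (sum⁺-syntax)

-- The floors are natural-number quotients, but they are combined in ℤ since a
-- summand can be negative.
summand : (m : ℕ) .{{_ : NonZero m}} → (a₁ a₂ a₃ k : ℕ) → ℤ
summand m a₁ a₂ a₃ k =
    ⌊ a₁ ℕ.+ a₂ ℕ.+ a₃ ℕ.+ k ⌋
  - ⌊ a₁ ℕ.+ a₂ ℕ.+ k ⌋ - ⌊ a₂ ℕ.+ a₃ ℕ.+ k ⌋ - ⌊ a₁ ℕ.+ a₃ ℕ.+ k ⌋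
  + ⌊ a₁ ℕ.+ k ⌋ + ⌊ a₂ ℕ.+ k ⌋ + ⌊ a₃ ℕ.+ k ⌋
  - ⌊ k ⌋
  where
  ⌊_⌋ : ℕ → ℤ
  ⌊ n ⌋ = + (n / m)

S : (m : ℕ) .{{_ : NonZero m}} → (a₁ a₂ a₃ K : ℕ) → ℤ
S m a₁ a₂ a₃ K = ∑[ k ≤ K ] summand m a₁ a₂ a₃ (toℕ k)

{-# OPTIONS --safe #-}
-- Let F n = Σ_{j<n} ⌊j/m⌋.  Then S is the fourth difference of F at 0 with steps
-- a₁, a₂, a₃, K + 1, hence symmetric in four steps a, b, c, d ∈ [0, m].  Since
-- F (j m - n) - F n is quadratic in j and n, and third differences kill quadratic
-- terms, replacing every step x by m - x does
-- not change it, so one may assume a + b + c + d ≤ 2m.  On [0, 2m], F is the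
-- hinge n ↦ max 0 (n - m).  If two of the steps, say c and d, have sum at least m,
-- then F is linear between c + d and a + b + c + d and zero up to a + b, and
-- convexity makes the fourth difference nonpositive.  Otherwise it is
-- F s - Σ F (s - x) with s = a + b + c + d and x running over the steps, and
-- 3 (s - m) - Σ (s - x - m) = m.
module Submission where

open import Defs
open import Algebra.Properties.CommutativeMonoid.Sum
  using (sum; sum-cong-≗)
open import Data.Fin.Base using (toℕ)
open import Data.Integer.Base as ℤ using (ℤ; +_; -[1+_]; 0ℤ; 1ℤ; +≤+; -≤+)
import Data.Integer.Properties as ℤ
import Data.Integer.Tactic.RingSolver as ℤ-Solver
open import Data.Nat.Base using (ℕ; NonZero; zero; suc; _+_; _*_; _∸_; _≤_; _/_; z≤n; s≤s)
open import Data.Nat.Divisibility using (∣-refl)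
open import Data.Nat.DivMod
open import Data.Nat.Properties
open import Data.Nat.Tactic.RingSolver using (solve-∀)
open import Data.Product.Base using (_,_)
open import Data.Sum.Base using (inj₁; inj₂)
open import Relation.Binary.PropositionalEquality

-- Integer arithmetic.

-- Lets the ring solver handle an identity that holds only modulo a hypothesis `x ≡ y`: the
-- vanishing difference is written out as an extra term.
≡-modulo : ∀ {p q x y : ℤ} → x ≡ y → p ≡ q ℤ.+ (x ℤ.- y) → p ≡ q
≡-modulo {q = q} {x} refl p≡q+0 =
  trans p≡q+0 (trans (cong (λ z → q ℤ.+ z) (ℤ.+-inverseʳ x)) (ℤ.+-identityʳ q))

i*3≤n⇒i≤n/3 : ∀ {i n} → i ℤ.* + 3 ℤ.≤ + n → i ℤ.≤ + (n / 3)
i*3≤n⇒i≤n/3 { -[1+ _ ]} _ = -≤+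
i*3≤n⇒i≤n/3 {+ i} {n} 3i≤n = +≤+ (subst (_≤ n / 3) (m*n/n≡m i 3)
  (/-monoˡ-≤ 3 (ℤ.drop‿+≤+ (subst (ℤ._≤ + n) (sym (ℤ.pos-* i 3)) 3i≤n))))

+-swap : ∀ x y z → x + (y + z) ≡ y + (x + z)
+-swap = solve-∀

-- Finite differences.

Δ : ℕ → (ℕ → ℤ) → ℕ → ℤ
Δ a f n = f (a + n) ℤ.- f n

Δ-cong : ∀ a {f g} → f ≗ g → Δ a f ≗ Δ a g
Δ-cong a f≗g n = cong₂ ℤ._-_ (f≗g (a + n)) (f≗g n)

Δ-comm : ∀ a b f → Δ a (Δ b f) ≗ Δ b (Δ a f)
Δ-comm a b f n = begin
  (f (b + (a + n)) ℤ.- f (a + n)) ℤ.- (f (b + n) ℤ.- f n)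
    ≡⟨ cong (λ x → (f x ℤ.- f (a + n)) ℤ.- (f (b + n) ℤ.- f n)) (+-swap b a n) ⟩
  (f (a + (b + n)) ℤ.- f (a + n)) ℤ.- (f (b + n) ℤ.- f n)
    ≡⟨ interchange (f (a + (b + n))) (f (a + n)) (f (b + n)) (f n) ⟩
  (f (a + (b + n)) ℤ.- f (b + n)) ℤ.- (f (a + n) ℤ.- f n)
    ∎
  where
  open ≡-Reasoning
  interchange : ∀ x y z w → (x ℤ.- y) ℤ.- (z ℤ.- w) ≡ (x ℤ.- z) ℤ.- (y ℤ.- w)
  interchange = ℤ-Solver.solve-∀

Δ³ : (ℕ → ℤ) → (a b c : ℕ) → ℕ → ℤ
Δ³ f a b c = Δ c (Δ b (Δ a f))

Δ⁴ : (ℕ → ℤ) → (a b c d : ℕ) → ℤ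
Δ⁴ f a b c d = Δ d (Δ³ f a b c) 0

Δ⁴-swap₁₂ : ∀ f a b c d → Δ⁴ f a b c d ≡ Δ⁴ f b a c d
Δ⁴-swap₁₂ f a b c d = Δ-cong d (Δ-cong c (Δ-comm b a f)) 0

Δ⁴-swap₂₃ : ∀ f a b c d → Δ⁴ f a b c d ≡ Δ⁴ f a c b d
Δ⁴-swap₂₃ f a b c d = Δ-cong d (Δ-comm c b (Δ a f)) 0

Δ⁴-swap₃₄ : ∀ f a b c d → Δ⁴ f a b c d ≡ Δ⁴ f a b d c
Δ⁴-swap₃₄ f a b c d = Δ-comm d c (Δ b (Δ a f)) 0

∑-telescope : ∀ f n → sum ℤ.+-0-commutativeMonoid {n} (λ i → Δ 1 f (toℕ i)) ≡ f n ℤ.- f 0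
∑-telescope f zero    = sym (ℤ.+-inverseʳ (f 0))
∑-telescope f (suc n) = trans
  (cong (λ z → Δ 1 f 0 ℤ.+ z) (∑-telescope (λ k → f (suc k)) n))
  (cancel (f (suc n)) (f 1) (f 0))
  where
  cancel : ∀ x y z → (y ℤ.- z) ℤ.+ (x ℤ.- y) ≡ x ℤ.- z
  cancel = ℤ-Solver.solve-∀

-- The value at `j` is 0 + 1 + ... + (j - 1) = j (j - 1) / 2, the coefficient of `m` in the
-- reflection formula for `F`.
triangular : ℕ → ℕ
triangular zero    = 0
triangular (suc j) = j + triangular j

-- Partial sums of the floor function.

module _ (m : ℕ) .{{_ : NonZero m}} where

  2m≡m+m : 2 * m ≡ m + m
  2m≡m+m = cong (λ x → m + x) (+-identityʳ m)

  F : ℕ → ℕ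
  F zero    = 0
  F (suc n) = F n + n / m

  F≡0 : ∀ {n} → n ≤ m → F n ≡ 0
  F≡0 {zero}  _   = refl
  F≡0 {suc n} n<m = cong₂ _+_ (F≡0 (<⇒≤ n<m)) (m<n⇒m/n≡0 n<m)

  -- The first `m` floors vanish, and shifting by `m` raises each of the next `n` floors by one.
  F[m+n]≡F[n]+n : ∀ n → F (m + n) ≡ F n + n
  F[m+n]≡F[n]+n zero    = trans (cong F (+-identityʳ m)) (F≡0 ≤-refl)
  F[m+n]≡F[n]+n (suc n) = begin
    F (m + suc n)            ≡⟨ cong F (+-suc m n) ⟩
    F (m + n) + (m + n) / m  ≡⟨ cong₂ _+_ (F[m+n]≡F[n]+n n) [m+n]/m≡1+n/m ⟩
    F n + n + (1 + n / m)    ≡⟨ rearrange (F n) n (n / m) ⟩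
    F n + n / m + suc n      ∎
    where
    open ≡-Reasoning
    [m+n]/m≡1+n/m : (m + n) / m ≡ 1 + n / m
    [m+n]/m≡1+n/m = trans (+-distrib-/-∣ˡ n ∣-refl) (cong (λ q → q + n / m) (n/n≡1 m))
    rearrange : ∀ x y z → x + y + (1 + z) ≡ x + z + (1 + y)
    rearrange = solve-∀

  f : ℕ → ℤ
  f n = + F n

  -- The hinge as a lower bound for `F`, valid on all of ℕ, so triple sums need no case split at
  -- `m`.
  n≤F[n]+m : ∀ n → n ≤ F n + m
  n≤F[n]+m n with ≤-total n m
  ... | inj₁ n≤m = ≤-trans n≤m (m≤n+m m (F n))
  ... | inj₂ m≤n with k , refl ← m≤n⇒∃[o]m+o≡n m≤n
    rewrite F[m+n]≡F[n]+n k = subst (_≤ F k + k + m) (+-comm k m) (+-monoˡ-≤ m (m≤n+m k (F k)))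

  f≡n-m : ∀ {n} → m ≤ n → n ≤ 2 * m → f n ≡ + n ℤ.- + m
  f≡n-m m≤n n≤2m with k , refl ← m≤n⇒∃[o]m+o≡n m≤n
    rewrite F[m+n]≡F[n]+n k | F≡0 (+-cancelˡ-≤ m k m (subst (m + k ≤_) 2m≡m+m n≤2m))
    = cancel (+ k) (+ m)
    where
    cancel : ∀ x y → x ≡ (y ℤ.+ x) ℤ.- y
    cancel = ℤ-Solver.solve-∀

  -- The increments `n / m` of `F` are monotone in `n`; induction on `a` compares them one at a
  -- time.
  F-convex : ∀ a b n → F (a + n) + F (b + n) ≤ F (a + (b + n)) + F n
  F-convex zero    b n = ≤-reflexive (+-comm (F n) (F (b + n)))
  F-convex (suc a) b n = begin
    F (a + n) + (a + n) / m + F (b + n)              ≡⟨ swap (F (a + n)) ((a + n) / m) (F (b + n)) ⟩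
    F (a + n) + F (b + n) + (a + n) / m              ≤⟨ +-mono-≤ (F-convex a b n) (/-monoˡ-≤ m (+-monoʳ-≤ a (m≤n+m n b))) ⟩
    F (a + (b + n)) + F n + (a + (b + n)) / m        ≡⟨ swap (F (a + (b + n))) (F n) ((a + (b + n)) / m) ⟩
    F (a + (b + n)) + (a + (b + n)) / m + F n        ∎
    where
    open ≤-Reasoning
    swap : ∀ x y z → x + y + z ≡ x + z + y
    swap = solve-∀

  Δ²-nonNeg : ∀ a b n → 0ℤ ℤ.≤ Δ b (Δ a f) n
  Δ²-nonNeg a b n = subst (0ℤ ℤ.≤_) (rearrange (f (a + (b + n))) (f n) (f (a + n)) (f (b + n)))
    (ℤ.i≤j⇒0≤j-i (+≤+ (F-convex a b n)))
    where
    rearrange : ∀ x y z w → (x ℤ.+ y) ℤ.- (z ℤ.+ w) ≡ (x ℤ.- w) ℤ.- (z ℤ.- y)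
    rearrange = ℤ-Solver.solve-∀

  -- Reflection of the steps.

  -- Here `n'` stands for `j * m - n`; the equation on the sum avoids truncated subtraction.
  FReflects : ℕ → Set
  FReflects j = ∀ n n' → n + n' ≡ j * m →
    f n ≡ f n' ℤ.+ (+ j ℤ.- 1ℤ) ℤ.* + n ℤ.- + triangular j ℤ.* + m

  -- A total of at least `2 * m` forces one of `n`, `n'` to be at least `m`; removing one `m` from
  -- it lowers the index by one.
  f-reflect-suc : ∀ j → FReflects (suc j) → FReflects (suc (suc j))
  f-reflect-suc j reflect n n' n+n'≡jm with ≤-total m n
  ... | inj₁ m≤n with k , refl ← m≤n⇒∃[o]m+o≡n m≤n = begin
    f (m + k)        ≡⟨ cong +_ (F[m+n]≡F[n]+n k) ⟩
    f k ℤ.+ + k      ≡⟨ cong (λ z → z ℤ.+ + k) (reflect k n' k+n') ⟩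
    _                ≡⟨ rearrange (f n') (+ j) (+ k) (+ triangular (suc j)) (+ m) ⟩
    _                ∎
    where
    open ≡-Reasoning
    k+n' : k + n' ≡ suc j * m
    k+n' = +-cancelˡ-≡ m _ _ (trans (sym (+-assoc m k n')) n+n'≡jm)
    rearrange : ∀ x j k t m →
      x ℤ.+ (1ℤ ℤ.+ j ℤ.- 1ℤ) ℤ.* k ℤ.- t ℤ.* m ℤ.+ k ≡
      x ℤ.+ (+ 2 ℤ.+ j ℤ.- 1ℤ) ℤ.* (m ℤ.+ k) ℤ.- (1ℤ ℤ.+ j ℤ.+ t) ℤ.* m
    rearrange = ℤ-Solver.solve-∀
  ... | inj₂ n≤m with k , refl ← m≤n⇒∃[o]m+o≡n
      (+-cancelˡ-≤ m m n' (≤-trans (+-monoʳ-≤ m (m≤m+n m (j * m)))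
        (≤-trans (≤-reflexive (sym n+n'≡jm)) (+-monoˡ-≤ n' n≤m))))
    = trans (reflect n k n+k)
        (trans (≡-modulo (sym (trans (cong +_ n+k) (ℤ.pos-* (suc j) m))) (rearrange (f k) (+ j) (+ n) (+ k) (+ triangular (suc j)) (+ m)))
          (cong (λ x → + x ℤ.+ (+ suc (suc j) ℤ.- 1ℤ) ℤ.* + n ℤ.- + triangular (suc (suc j)) ℤ.* + m) (sym (F[m+n]≡F[n]+n k))))
    where
    n+k : n + k ≡ suc j * m
    n+k = +-cancelˡ-≡ m _ _ (trans (+-swap m n k) n+n'≡jm)
    rearrange : ∀ x j n k t m →
      x ℤ.+ (1ℤ ℤ.+ j ℤ.- 1ℤ) ℤ.* n ℤ.- t ℤ.* m ≡
      (x ℤ.+ k ℤ.+ (+ 2 ℤ.+ j ℤ.- 1ℤ) ℤ.* n ℤ.- (1ℤ ℤ.+ j ℤ.+ t) ℤ.* m)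
        ℤ.+ ((1ℤ ℤ.+ j) ℤ.* m ℤ.- (n ℤ.+ k))
    rearrange = ℤ-Solver.solve-∀

  f-reflect : ∀ j → FReflects j
  f-reflect zero zero zero _ = refl
  f-reflect (suc zero) n n' n+n'≡m
    rewrite F≡0 {n} (m+n≤o⇒m≤o n (≤-reflexive (trans n+n'≡m (+-identityʳ m))))
          | F≡0 {n'} (m+n≤o⇒n≤o n (≤-reflexive (trans n+n'≡m (+-identityʳ m))))
    = vanish (+ n) (+ m)
    where
    vanish : ∀ x y → 0ℤ ≡ 0ℤ ℤ.+ (1ℤ ℤ.- 1ℤ) ℤ.* x ℤ.- 0ℤ ℤ.* y
    vanish = ℤ-Solver.solve-∀
  f-reflect (suc (suc j)) = f-reflect-suc j (f-reflect (suc j))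

  +-reflect : ∀ j a a' n n' → a + a' ≡ m → n + n' ≡ j * m → (a + n) + (a' + n') ≡ suc j * m
  +-reflect j a a' n n' a+a' n+n' = trans (interchange a n a' n') (cong₂ _+_ a+a' n+n')
    where
    interchange : ∀ x y z w → (x + y) + (z + w) ≡ (x + z) + (y + w)
    interchange = solve-∀

  -- Moving from `n` to `a + n` raises the index from `j` to `suc j`, because `a + a'` adds one `m`.
  -- The quadratic correction thereby becomes linear.
  Δ-reflect : ∀ j a a' n n' → a + a' ≡ m → n + n' ≡ j * m →
              Δ a f n ≡ Δ a' f n' ℤ.+ + j ℤ.* + a ℤ.- + n'
  Δ-reflect j a a' n n' a+a' n+n' = trans
    (cong₂ ℤ._-_ (f-reflect (suc j) (a + n) (a' + n') (+-reflect j a a' n n' a+a' n+n')) (f-reflect j n n' n+n'))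
    (≡-modulo (trans (cong +_ n+n') (ℤ.pos-* j m))
      (rearrange (f (a' + n')) (f n') (+ j) (+ a) (+ n) (+ n') (+ triangular j) (+ m)))
    where
    rearrange : ∀ x y j a n n' t m →
      (x ℤ.+ (1ℤ ℤ.+ j ℤ.- 1ℤ) ℤ.* (a ℤ.+ n) ℤ.- (j ℤ.+ t) ℤ.* m) ℤ.-
      (y ℤ.+ (j ℤ.- 1ℤ) ℤ.* n ℤ.- t ℤ.* m) ≡
      (x ℤ.- y ℤ.+ j ℤ.* a ℤ.- n') ℤ.+ ((n ℤ.+ n') ℤ.- j ℤ.* m)
    rearrange = ℤ-Solver.solve-∀

  -- The correction left over no longer depends on `j` or the base point, so one more difference
  -- removes it.
  Δ²-reflect : ∀ j a a' b b' n n' → a + a' ≡ m → b + b' ≡ m → n + n' ≡ j * m →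
               Δ b (Δ a f) n ≡ Δ b' (Δ a' f) n' ℤ.+ + a ℤ.- + b'
  Δ²-reflect j a a' b b' n n' a+a' b+b' n+n' = trans
    (cong₂ ℤ._-_ (Δ-reflect (suc j) a a' (b + n) (b' + n') a+a' (+-reflect j b b' n n' b+b' n+n'))
                 (Δ-reflect j a a' n n' a+a' n+n'))
    (rearrange (Δ a' f (b' + n')) (Δ a' f n') (+ j) (+ a) (+ b') (+ n'))
    where
    rearrange : ∀ x y j a b' n' →
      (x ℤ.+ (1ℤ ℤ.+ j) ℤ.* a ℤ.- (b' ℤ.+ n')) ℤ.- (y ℤ.+ j ℤ.* a ℤ.- n') ≡
      x ℤ.- y ℤ.+ a ℤ.- b'
    rearrange = ℤ-Solver.solve-∀

  Δ³-reflect : ∀ j a a' b b' c c' n n' → a + a' ≡ m → b + b' ≡ m → c + c' ≡ m → n + n' ≡ j * m →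
               Δ³ f a b c n ≡ Δ³ f a' b' c' n'
  Δ³-reflect j a a' b b' c c' n n' a+a' b+b' c+c' n+n' = trans
    (cong₂ ℤ._-_ (Δ²-reflect (suc j) a a' b b' (c + n) (c' + n') a+a' b+b' (+-reflect j c c' n n' c+c' n+n'))
                 (Δ²-reflect j a a' b b' n n' a+a' b+b' n+n'))
    (cancel (Δ b' (Δ a' f) (c' + n')) (Δ b' (Δ a' f) n') (+ a) (+ b'))
    where
    cancel : ∀ x y z w → (x ℤ.+ z ℤ.- w) ℤ.- (y ℤ.+ z ℤ.- w) ≡ x ℤ.- y
    cancel = ℤ-Solver.solve-∀

  Δ⁴-reflect : ∀ a a' b b' c c' d d' → a + a' ≡ m → b + b' ≡ m → c + c' ≡ m → d + d' ≡ m →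
               Δ⁴ f a b c d ≡ Δ⁴ f a' b' c' d'
  Δ⁴-reflect a a' b b' c c' d d' a+a' b+b' c+c' d+d' = cong₂ ℤ._-_
    -- The base points `d` and `d'` add up to `m`, giving index 1; the base point 0 is its own
    -- reflection at index 0.
    (Δ³-reflect 1 a a' b b' c c' (d + 0) (d' + 0) a+a' b+b' c+c' (+-reflect 0 d d' 0 0 d+d' refl))
    (Δ³-reflect 0 a a' b b' c c' 0 0 a+a' b+b' c+c' refl)

  -- Bounds for steps of sum at most `2 * m`.

  module _ (a b c d : ℕ) (s≤2m : a + (b + (c + d)) ≤ 2 * m) where

    Δ⁴-largePair₃₄ : m ≤ c + d → Δ⁴ f a b c d ℤ.≤ 0ℤ
    Δ⁴-largePair₃₄ m≤c+d rewrite +-identityʳ d | +-identityʳ c = begin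
      (g (c + d) ℤ.- g d) ℤ.- (g c ℤ.- g 0)
        ≡⟨ cong₂ (λ x y → (x ℤ.- g d) ℤ.- (g c ℤ.- y)) g[c+d]≡0 g[0]≡0 ⟩
      (0ℤ ℤ.- g d) ℤ.- (g c ℤ.- 0ℤ)
        ≡⟨ rearrange (g c) (g d) ⟩
      ℤ.- (g c ℤ.+ g d)
        ≤⟨ ℤ.neg-mono-≤ (ℤ.+-mono-≤ (Δ²-nonNeg a b c) (Δ²-nonNeg a b d)) ⟩
      0ℤ
        ∎
      where
      open ℤ.≤-Reasoning
      g : ℕ → ℤ
      g = Δ b (Δ a f)
      a+b≤m : a + b ≤ m
      a+b≤m = +-cancelʳ-≤ m (a + b) m (≤-trans (+-monoʳ-≤ (a + b) m≤c+d)
        (≤-trans (≤-reflexive (+-assoc a b (c + d))) (≤-trans s≤2m (≤-reflexive 2m≡m+m))))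
      b+x≤s : b + (c + d) ≤ a + (b + (c + d))
      b+x≤s = m≤n+m (b + (c + d)) a
      a+x≤s : a + (c + d) ≤ a + (b + (c + d))
      a+x≤s = +-monoʳ-≤ a (m≤n+m (c + d) b)
      g[c+d]≡0 : g (c + d) ≡ 0ℤ
      g[c+d]≡0 = trans
        (cong₂ ℤ._-_
          (cong₂ ℤ._-_ (f≡n-m (≤-trans m≤c+d (≤-trans (m≤n+m (c + d) b) b+x≤s)) s≤2m)
                       (f≡n-m (≤-trans m≤c+d (m≤n+m (c + d) b)) (≤-trans b+x≤s s≤2m)))
          (cong₂ ℤ._-_ (f≡n-m (≤-trans m≤c+d (m≤n+m (c + d) a)) (≤-trans a+x≤s s≤2m))
                       (f≡n-m m≤c+d (≤-trans (m≤n+m (c + d) a) (≤-trans a+x≤s s≤2m)))))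
        (cancel (+ a) (+ b) (+ (c + d)) (+ m))
        where
        cancel : ∀ a b x m → ((a ℤ.+ (b ℤ.+ x) ℤ.- m) ℤ.- (b ℤ.+ x ℤ.- m)) ℤ.-
                             ((a ℤ.+ x ℤ.- m) ℤ.- (x ℤ.- m)) ≡ 0ℤ
        cancel = ℤ-Solver.solve-∀
      g[0]≡0 : g 0 ≡ 0ℤ
      g[0]≡0 rewrite +-identityʳ a | +-identityʳ b
        | F≡0 a+b≤m | F≡0 (m+n≤o⇒m≤o a a+b≤m) | F≡0 (m+n≤o⇒n≤o a a+b≤m) = refl
      rearrange : ∀ x y → (0ℤ ℤ.- y) ℤ.- (x ℤ.- 0ℤ) ≡ ℤ.- (x ℤ.+ y)
      rearrange = ℤ-Solver.solve-∀

    -- `F` vanishes at 0, at single steps and at pair sums, leaving only the total and the four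
    -- triple sums. In both cases the difference of the two sides is rewritten as a sum of natural
    -- numbers.
    Δ⁴-smallPairs : a + b ≤ m → a + c ≤ m → a + d ≤ m → b + c ≤ m → b + d ≤ m → c + d ≤ m →
                    Δ⁴ f a b c d ℤ.* + 3 ℤ.≤ + m
    Δ⁴-smallPairs ab ac ad bc bd cd
      rewrite +-identityʳ d | +-identityʳ c | +-identityʳ b | +-identityʳ a
        | F≡0 ab | F≡0 ac | F≡0 ad | F≡0 bc | F≡0 bd | F≡0 cd
        | F≡0 (m+n≤o⇒m≤o a ab) | F≡0 (m+n≤o⇒n≤o a ab) | F≡0 (m+n≤o⇒m≤o c cd) | F≡0 (m+n≤o⇒n≤o c cd)
      with ≤-total (a + (b + (c + d))) m
         | m≤n⇒∃[o]m+o≡n (n≤F[n]+m (b + (c + d))) | m≤n⇒∃[o]m+o≡n (n≤F[n]+m (a + (c + d)))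
         | m≤n⇒∃[o]m+o≡n (n≤F[n]+m (a + (b + d))) | m≤n⇒∃[o]m+o≡n (n≤F[n]+m (a + (b + c)))
    ... | inj₁ s≤m | _ | _ | _ | _ rewrite F≡0 s≤m = ℤ.0≤i-j⇒j≤i
      (subst (0ℤ ℤ.≤_)
        (expand (f (b + (c + d))) (f (a + (c + d))) (f (a + (b + d))) (f (a + (b + c))) (+ m))
        (+≤+ z≤n))
      where
      expand : ∀ p q r t m → m ℤ.+ (p ℤ.+ q ℤ.+ r ℤ.+ t) ℤ.+ ((p ℤ.+ q ℤ.+ r ℤ.+ t) ℤ.+ (p ℤ.+ q ℤ.+ r ℤ.+ t)) ≡
        m ℤ.- (((0ℤ ℤ.- p) ℤ.- (q ℤ.- 0ℤ)) ℤ.- ((r ℤ.- 0ℤ) ℤ.- 0ℤ) ℤ.- (((t ℤ.- 0ℤ) ℤ.- 0ℤ) ℤ.- 0ℤ)) ℤ.* + 3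
      expand = ℤ-Solver.solve-∀
    -- The difference of the two sides is `p + q + r + t` plus twice the sum of `F` over the four
    -- triple sums.
    ... | inj₂ m≤s | p , eqp | q , eqq | r , eqr | t , eqt rewrite f≡n-m m≤s s≤2m = ℤ.0≤i-j⇒j≤i
      (subst (0ℤ ℤ.≤_)
        (≡-modulo (cong +_ (cong₂ _+_ (cong₂ _+_ eqp eqq) (cong₂ _+_ eqr eqt)))
          (expand (f (b + (c + d))) (f (a + (c + d))) (f (a + (b + d))) (f (a + (b + c)))
                  (+ p) (+ q) (+ r) (+ t) (+ a) (+ b) (+ c) (+ d) (+ m)))
        (+≤+ z≤n))
      where
      -- p, q, r, t are the slacks of x ≤ F x + m at the four triple sums x.
      expand : ∀ P Q R T p q r t a b c d m →
        (p ℤ.+ q ℤ.+ r ℤ.+ t) ℤ.+ ((P ℤ.+ Q ℤ.+ R ℤ.+ T) ℤ.+ (P ℤ.+ Q ℤ.+ R ℤ.+ T)) ≡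
        (m ℤ.- (((a ℤ.+ (b ℤ.+ (c ℤ.+ d)) ℤ.- m ℤ.- P) ℤ.- (Q ℤ.- 0ℤ)) ℤ.- ((R ℤ.- 0ℤ) ℤ.- 0ℤ) ℤ.- (((T ℤ.- 0ℤ) ℤ.- 0ℤ) ℤ.- 0ℤ)) ℤ.* + 3)
        ℤ.+ ((((b ℤ.+ (c ℤ.+ d) ℤ.+ p) ℤ.+ (a ℤ.+ (c ℤ.+ d) ℤ.+ q)) ℤ.+ ((a ℤ.+ (b ℤ.+ d) ℤ.+ r) ℤ.+ (a ℤ.+ (b ℤ.+ c) ℤ.+ t)))
             ℤ.- (((P ℤ.+ m) ℤ.+ (Q ℤ.+ m)) ℤ.+ ((R ℤ.+ m) ℤ.+ (T ℤ.+ m))))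
      expand = ℤ-Solver.solve-∀

  private
    -- The bound on the sum is kept inside, so that permuting the steps transports it too.
    LargePairBound : (a b c d : ℕ) → Set
    LargePairBound a b c d = a + (b + (c + d)) ≤ 2 * m → Δ⁴ f a b c d ℤ.≤ 0ℤ

    swap₁₂ : ∀ a b c d → LargePairBound b a c d → LargePairBound a b c d
    swap₁₂ a b c d bound s≤2m = subst (ℤ._≤ 0ℤ) (Δ⁴-swap₁₂ f b a c d)
      (bound (subst (_≤ 2 * m) (+-swap a b (c + d)) s≤2m))

    swap₂₃ : ∀ a b c d → LargePairBound a c b d → LargePairBound a b c d
    swap₂₃ a b c d bound s≤2m = subst (ℤ._≤ 0ℤ) (Δ⁴-swap₂₃ f a c b d)
      (bound (subst (_≤ 2 * m) (cong (λ x → a + x) (+-swap b c d)) s≤2m))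

    swap₃₄ : ∀ a b c d → LargePairBound a b d c → LargePairBound a b c d
    swap₃₄ a b c d bound s≤2m = subst (ℤ._≤ 0ℤ) (Δ⁴-swap₃₄ f a b d c)
      (bound (subst (_≤ 2 * m) (cong (λ x → a + (b + x)) (+-comm c d)) s≤2m))

  Δ⁴≤m/3-lower : ∀ a b c d → a + (b + (c + d)) ≤ 2 * m → Δ⁴ f a b c d ℤ.≤ + (m / 3)
  Δ⁴≤m/3-lower a b c d s≤2m
    with ≤-total (a + b) m | ≤-total (a + c) m | ≤-total (a + d) m
       | ≤-total (b + c) m | ≤-total (b + d) m | ≤-total (c + d) m
  ... | inj₁ ab | inj₁ ac | inj₁ ad | inj₁ bc | inj₁ bd | inj₁ cd =
    i*3≤n⇒i≤n/3 (Δ⁴-smallPairs a b c d s≤2m ab ac ad bc bd cd)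
  -- In this and the remaining cases, adjacent transpositions bring the large pair to the last two
  -- places.
  ... | inj₂ ab | _ | _ | _ | _ | _ = ℤ.≤-trans
    (swap₂₃ a b c d (swap₁₂ a c b d (swap₃₄ c a b d (swap₂₃ c a d b
      (λ s → Δ⁴-largePair₃₄ c d a b s ab)))) s≤2m) (+≤+ z≤n)
  ... | _ | inj₂ ac | _ | _ | _ | _ = ℤ.≤-trans
    (swap₃₄ a b c d (swap₁₂ a b d c (swap₂₃ b a d c
      (λ s → Δ⁴-largePair₃₄ b d a c s ac))) s≤2m) (+≤+ z≤n)
  ... | _ | _ | inj₂ ad | _ | _ | _ = ℤ.≤-trans
    (swap₁₂ a b c d (swap₂₃ b a c d
      (λ s → Δ⁴-largePair₃₄ b c a d s ad)) s≤2m) (+≤+ z≤n)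
  ... | _ | _ | _ | inj₂ bc | _ | _ = ℤ.≤-trans
    (swap₃₄ a b c d (swap₂₃ a b d c
      (λ s → Δ⁴-largePair₃₄ a d b c s bc)) s≤2m) (+≤+ z≤n)
  ... | _ | _ | _ | _ | inj₂ bd | _ = ℤ.≤-trans
    (swap₂₃ a b c d
      (λ s → Δ⁴-largePair₃₄ a c b d s bd) s≤2m) (+≤+ z≤n)
  ... | _ | _ | _ | _ | _ | inj₂ cd = ℤ.≤-trans
    (Δ⁴-largePair₃₄ a b c d s≤2m cd) (+≤+ z≤n)

  Δ⁴≤m/3 : ∀ a b c d → a ≤ m → b ≤ m → c ≤ m → d ≤ m → Δ⁴ f a b c d ℤ.≤ + (m / 3)
  Δ⁴≤m/3 a b c d a≤m b≤m c≤m d≤m with ≤-total (a + (b + (c + d))) (2 * m)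
  ... | inj₁ s≤2m = Δ⁴≤m/3-lower a b c d s≤2m
  ... | inj₂ 2m≤s
    with a' , a+a' ← m≤n⇒∃[o]m+o≡n a≤m | b' , b+b' ← m≤n⇒∃[o]m+o≡n b≤m
       | c' , c+c' ← m≤n⇒∃[o]m+o≡n c≤m | d' , d+d' ← m≤n⇒∃[o]m+o≡n d≤m
    -- The steps and their complements total `4 * m`, so the complements sum to at most `2 * m`.
    = subst (ℤ._≤ + (m / 3)) (sym (Δ⁴-reflect a a' b b' c c' d d' a+a' b+b' c+c' d+d'))
        (Δ⁴≤m/3-lower a' b' c' d' s'≤2m)
    where
    rearrange : ∀ a b c d a' b' c' d' →
      (a + (b + (c + d))) + (a' + (b' + (c' + d'))) ≡ (a + a') + ((b + b') + ((c + c') + (d + d')))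
    rearrange = solve-∀
    s+s'≡4m : (a + (b + (c + d))) + (a' + (b' + (c' + d'))) ≡ 2 * m + 2 * m
    s+s'≡4m = trans (rearrange a b c d a' b' c' d')
      (trans (cong₂ _+_ a+a' (cong₂ _+_ b+b' (cong₂ _+_ c+c' d+d'))) (double m))
      where
      double : ∀ m → m + (m + (m + m)) ≡ 2 * m + 2 * m
      double = solve-∀
    s'≤2m : a' + (b' + (c' + d')) ≤ 2 * m
    s'≤2m = +-cancelˡ-≤ (2 * m) _ _ (≤-trans (+-monoˡ-≤ _ 2m≤s) (≤-reflexive s+s'≡4m))

  -- `S` as a fourth difference.

  -- The summand is a third difference of the floor, which is itself `Δ 1 f`; commuting `Δ 1`
  -- outermost makes the sum over `k` telescope.
  summand≡Δ : ∀ a b c k → summand m a b c k ≡ Δ 1 (Δ³ f a b c) k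
  summand≡Δ a b c k = begin
    summand m a b c k               ≡⟨ expand ⟩
    Δ³ (λ n → + (n / m)) a b c k    ≡⟨ Δ-cong c (Δ-cong b (Δ-cong a λ n → step (f n) (+ (n / m)))) k ⟩
    Δ³ (Δ 1 f) a b c k              ≡⟨ Δ-cong c (Δ-cong b (Δ-comm a 1 f)) k ⟩
    Δ c (Δ b (Δ 1 (Δ a f))) k       ≡⟨ Δ-cong c (Δ-comm b 1 (Δ a f)) k ⟩
    Δ c (Δ 1 (Δ b (Δ a f))) k       ≡⟨ Δ-comm c 1 (Δ b (Δ a f)) k ⟩
    Δ 1 (Δ³ f a b c) k              ∎
    where
    open ≡-Reasoning
    step : ∀ x y → y ≡ (x ℤ.+ y) ℤ.- x
    step = ℤ-Solver.solve-∀
    rearrange : ∀ abc ab bc ac a b c z →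
      abc ℤ.- ab ℤ.- bc ℤ.- ac ℤ.+ a ℤ.+ b ℤ.+ c ℤ.- z ≡
      ((abc ℤ.- bc) ℤ.- (ac ℤ.- c)) ℤ.- ((ab ℤ.- b) ℤ.- (a ℤ.- z))
    rearrange = ℤ-Solver.solve-∀
    expand : summand m a b c k ≡ Δ³ (λ n → + (n / m)) a b c k
    expand rewrite +-assoc (a + b) c k | +-assoc a b (c + k) | +-assoc a b k
                 | +-assoc b c k | +-assoc a c k
      = rearrange (+ ((a + (b + (c + k))) / m)) (+ ((a + (b + k)) / m)) (+ ((b + (c + k)) / m))
                  (+ ((a + (c + k)) / m)) (+ ((a + k) / m)) (+ ((b + k) / m)) (+ ((c + k) / m)) (+ (k / m))

  S≡Δ⁴ : ∀ a b c K → S m a b c K ≡ Δ⁴ f a b c (suc K)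
  S≡Δ⁴ a b c K = begin
    S m a b c K                                    ≡⟨ sum-cong-≗ ℤ.+-0-commutativeMonoid {suc K} (λ i → summand≡Δ a b c (toℕ i)) ⟩
    _                                              ≡⟨ ∑-telescope (Δ³ f a b c) (suc K) ⟩
    Δ³ f a b c (suc K) ℤ.- Δ³ f a b c 0            ≡⟨ cong (λ n → Δ³ f a b c n ℤ.- Δ³ f a b c 0) (+-identityʳ (suc K)) ⟨
    Δ⁴ f a b c (suc K)                             ∎
    where open ≡-Reasoning

corollary14 : (m : ℕ) .{{_ : NonZero m}} (a₁ a₂ a₃ K : ℕ) →
    a₁ ≤ m ∸ 1 → a₂ ≤ m ∸ 1 → a₃ ≤ m ∸ 1 → K ≤ m ∸ 1 →
    S m a₁ a₂ a₃ K ℤ.≤ + (m / 3)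
corollary14 m@(suc _) a₁ a₂ a₃ K a₁≤m∸1 a₂≤m∸1 a₃≤m∸1 K≤m∸1 =
  subst (ℤ._≤ + (m / 3)) (sym (S≡Δ⁴ m a₁ a₂ a₃ K))
    -- The sum has `suc K` terms, so the fourth step can equal `m`; the bound for steps covers this
    -- endpoint.
    (Δ⁴≤m/3 m a₁ a₂ a₃ (suc K) (m≤n⇒m≤1+n a₁≤m∸1) (m≤n⇒m≤1+n a₂≤m∸1) (m≤n⇒m≤1+n a₃≤m∸1) (s≤s K≤m∸1))
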